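{- Let $v_1,\dots,v_m\in\mathbb{Q}^n$, let $P=P_{v_1,\dots,v_m}$, and let $a_1\le b_1,\dots,a_m\le b_m$ be elements of $\mathbb{Q}_P$. If $w\in\sum_{i=1}^m\mathbb{Q}_Pv_i$ can be written as $w=\sum_{i=1}^m x_iv_i$ with rational numbers $a_i\le x_i\le b_i$ ($i=1,\dots,m$), then there exist $y_1,\dots,y_m\in\mathbb{Q}_P$ with $a_i\le y_i\le b_i$ for all $i$ and $w=\sum_{i=1}^m y_iv_i$.
   Context: An elementary integral relation among $v_1,\dots,v_m$ is a relation $\sum_{i=1}^m a_iv_i=0$ with $a_i\in\mathbb{Z}$ not all zero, whose support $\{i:a_i\neq0\}$ is minimal (inclusion-wise) among supports of nontrivial linear relations, and whose coefficients have greatest common divisor $1$. $P_{v_1,\dots,v_m}$ is the (finite) set of primes $p$ for which there exists an elementary integral relation $\sum a_iv_i=0$ with $p\mid\prod_{a_i\neq0}a_i$. For a set of primes $P$, $\mathbb{Q}_P=\{a/b: a,b\in\mathbb{Z},\ b\neq0,\ \text{all prime factors of } b \text{ lie in } P\}$ (so $\mathbb{Q}_\emptyset=\mathbb{Z}$). -}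

module Defs where

open import Level using (0ℓ)
open import Algebra.Bundles using (CommutativeRing)
open import Data.Fin.Base using (Fin)
open import Data.Integer.Base as ℤ using (ℤ; +_; 0ℤ; 1ℤ)
open import Data.Integer.Divisibility as ℤ using () renaming (_∣_ to _∣ℤ_)
import Data.Integer.GCD as ℤ
import Data.Integer.Properties as ℤ
import Data.List.Base as List
open import Data.Nat.Base as ℕ using (ℕ)
open import Data.Nat.Divisibility using (_∣_)
open import Data.Nat.Primality using (Prime)
open import Data.Product.Base using (∃; ∃-syntax; Σ-syntax; _×_)
open import Data.Rational.Base using (ℚ; 0ℚ; _*_; _/_)
import Data.Rational.Properties as ℚ
open import Data.Vec.Functional using (Vector; foldr; map; toList)
open import Relation.Binary.PropositionalEquality using (_≡_; _≢_; _≗_)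
open import Relation.Nullary.Decidable using (¬?)
open import Relation.Unary using (Pred; _∈_; _⊆_; Satisfiable)

open import Algebra.Definitions.RawMonoid
  (CommutativeRing.+-rawMonoid ℚ.+-*-commutativeRing)
  public using (sum)

private
  variable
    m n : ℕ

fromℤ : ℤ → ℚ
fromℤ i = i / 1

linComb : Vector ℚ m → Vector (Vector ℚ n) m → Vector ℚ n
linComb c v j = sum (λ i → c i * v i j)

support : Vector ℚ m → Pred (Fin m) 0ℓ
support c i = c i ≢ 0ℚ

record IsNontrivialRelation (v : Vector (Vector ℚ n) m) (c : Vector ℚ m) : Set where
  field
    relation   : linComb c v ≗ (λ _ → 0ℚ)
    nontrivial : Satisfiable (support c)

record IsElementaryIntegralRelation (v : Vector (Vector ℚ n) m) (a : Vector ℤ m) : Set where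
  field
    isNontrivialRelation : IsNontrivialRelation v (map fromℤ a)
    minimalSupport       : ∀ (c : Vector ℚ m) → IsNontrivialRelation v c →
                           support c ⊆ support (map fromℤ a) →
                           support (map fromℤ a) ⊆ support c
    -- zero coefficients do not affect the gcd, as gcd 0 i = ∣ i ∣
    gcd≡1                : foldr ℤ.gcd 0ℤ a ≡ 1ℤ

nonzeroProduct : Vector ℤ m → ℤ
nonzeroProduct a = List.foldr ℤ._*_ 1ℤ (List.filter (λ i → ¬? (i ℤ.≟ 0ℤ)) (toList a))

relationPrimes : Vector (Vector ℚ n) m → Pred ℕ 0ℓ
relationPrimes v p =
  Prime p × (∃[ a ] IsElementaryIntegralRelation v a × (+ p) ∣ℤ nonzeroProduct a)

-- The denominator is a positive natural number, as in the library's _/_;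
-- the numerator carries the sign of the fraction.
ℚ[_] : Pred ℕ 0ℓ → Pred ℚ 0ℓ
ℚ[ P ] q = ∃[ a ] ∃[ b ] Σ[ b≢0 ∈ ℕ.NonZero b ]
  (∀ p → Prime p → p ∣ b → p ∈ P) × q ≡ (a / b) {{b≢0}}

-- A reduced echelon basis of the kernel of c ↦ Σ cᵢ vᵢ consists of vectors c with
-- a pivot entry 1 and minimal support. So c = a / aₚ with a an elementary integral
-- relation, p the pivot of c, and c has entries in ℚ_P. Hence an element of the
-- kernel lies in (ℚ_P)^m as soon as its pivot entries do.
--
-- Now move x along a basis vector until some coordinate i in its support reaches a
-- bound, and exchange i for the pivot of that vector. The other pivot entries do
-- not move, so after finitely many steps all pivot entries of x are bounds, i.e.
-- lie in ℚ_P. If z ∈ (ℚ_P)^m also represents w, the pivot entries of x - z are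
-- in ℚ_P, so x - z, and with it x, lies in (ℚ_P)^m.

{-# OPTIONS --safe #-}
module Submission where

open import Defs
open import Level using (0ℓ)
open import Algebra.Bundles using (CommutativeRing)
import Algebra.Properties.Semiring.Sum as SemiringSum
open import Data.Fin.Base using (Fin; zero; suc; toℕ; fromℕ; punchIn)
open import Data.Fin.Properties as Fin using (punchIn-injective; punchInᵢ≢i; punchIn-punchOut)
open import Data.Integer.Base as ℤ using (ℤ; +_; 0ℤ; 1ℤ)
open import Data.Integer.Divisibility as ℤ using () renaming (_∣_ to _∣ℤ_)
import Data.Integer.Divisibility.Signed as Signed
import Data.Integer.GCD as ℤ
import Data.Integer.Properties as ℤ
open import Data.List.Base as List using (List; []; _∷_)
open import Data.List.Membership.Propositional using () renaming (_∈_ to _∈ₗ_)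
open import Data.List.Membership.Propositional.Properties
  using (∈-tabulate⁺; ∈-filter⁺; ∈-allFin)
open import Data.List.Relation.Unary.Any using (here; there)
open import Data.Nat.Base as ℕ using (ℕ; zero; suc; s≤s)
open import Data.Nat.Divisibility as ℕ using (_∣_)
open import Data.Nat.Primality using (Prime; euclidsLemma; ¬prime[1])
import Data.Nat.Properties as ℕ
open import Data.Product.Base using (∃; ∃-syntax; Σ-syntax; _×_; _,_; proj₁; proj₂)
open import Data.Rational.Base
  using (ℚ; 0ℚ; 1ℚ; _+_; _*_; -_; _-_; 1/_; _/_; _≤_; NonZero; ≢-nonZero
        ; positive; negative; toℚᵘ; ↥_; ↧ₙ_)
open import Data.Rational.Properties as ℚ using (_≟_)
open import Data.Rational.Solver using (module +-*-Solver)
open import Data.Rational.Unnormalised.Base as ℚᵘ using (mkℚᵘ; *≡*)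
import Data.Rational.Unnormalised.Properties as ℚᵘ
open import Data.Sum.Base using (_⊎_; inj₁; inj₂; [_,_]′)
open import Data.Vec.Functional using (Vector; foldr; map; zipWith; replicate; updateAt)
open import Data.Vec.Functional.Properties using (updateAt-updates; updateAt-minimal)
open import Function.Base using (_∘_; id; case_of_)
open import Relation.Binary.Definitions using (tri<; tri≈; tri>)
open import Relation.Binary.PropositionalEquality
  using (_≡_; _≢_; _≗_; refl; sym; trans; cong; cong₂; subst; module ≡-Reasoning)
open import Relation.Nullary.Decidable using (yes; no; ¬?; decidable-stable)
open import Relation.Nullary.Negation using (contradiction)
open import Relation.Unary using (Pred; _∈_; _∩_; _⊆_)

open +-*-Solver using (solve; _:=_; _:+_; _:*_; :-_; con)
private module ∑ = SemiringSum (CommutativeRing.semiring ℚ.+-*-commutativeRing)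

private
  variable
    m n k : ℕ

-- Rational arithmetic

*≢0 : ∀ {p q} → p ≢ 0ℚ → q ≢ 0ℚ → p * q ≢ 0ℚ
*≢0 {p} {q} p≢0 q≢0 pq≡0 = q≢0 (begin
  q                ≡⟨ ℚ.*-identityˡ q ⟨
  1ℚ * q           ≡⟨ cong (_* q) (ℚ.*-inverseˡ p) ⟨
  1/ p * p * q     ≡⟨ ℚ.*-assoc (1/ p) p q ⟩
  1/ p * (p * q)   ≡⟨ cong (1/ p *_) pq≡0 ⟩
  1/ p * 0ℚ        ≡⟨ ℚ.*-zeroʳ (1/ p) ⟩
  0ℚ               ∎)
  where
  open ≡-Reasoning
  instance _ = ≢-nonZero p≢0

p-1q≡0⇒p≡q : ∀ p q → p + - 1ℚ * q ≡ 0ℚ → p ≡ q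
p-1q≡0⇒p≡q p q eq = begin
  p                     ≡⟨ solve 2 (λ p q → p := (p :+ (:- con 1ℚ) :* q) :+ q) refl p q ⟩
  (p + - 1ℚ * q) + q    ≡⟨ cong (_+ q) eq ⟩
  0ℚ + q                ≡⟨ ℚ.+-identityˡ q ⟩
  q                     ∎
  where open ≡-Reasoning

*-cancelʳ : ∀ {p q} r → r ≢ 0ℚ → p * r ≡ q * r → p ≡ q
*-cancelʳ {p} {q} r r≢0 eq = p-1q≡0⇒p≡q p q (decidable-stable (_ ≟ 0ℚ) λ ≢0 →
  *≢0 ≢0 r≢0 (begin
    (p + - 1ℚ * q) * r      ≡⟨ solve 3 (λ p q r → (p :+ (:- con 1ℚ) :* q) :* r := p :* r :+ (:- con 1ℚ) :* (q :* r)) refl p q r ⟩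
    p * r + - 1ℚ * (q * r)  ≡⟨ cong (λ s → s + - 1ℚ * (q * r)) eq ⟩
    q * r + - 1ℚ * (q * r)  ≡⟨ solve 1 (λ s → s :+ (:- con 1ℚ) :* s := con 0ℚ) refl (q * r) ⟩
    0ℚ                      ∎))
  where open ≡-Reasoning

-- Linear algebra

infixl 6 _⊕_
infixr 7 _⊙_

_⊕_ : Vector ℚ m → Vector ℚ m → Vector ℚ m
_⊕_ = zipWith _+_

_⊙_ : ℚ → Vector ℚ m → Vector ℚ m
q ⊙ u = map (q *_) u

-- Vectors are functions compared pointwise, so respect for `≗` has to be a field of its own.
record IsLinear (f : Vector ℚ m → ℚ) : Set where
  field
    f-cong : ∀ {u d} → u ≗ d → f u ≡ f d
    homo-⊕ : ∀ u d → f (u ⊕ d) ≡ f u + f d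
    homo-⊙ : ∀ q u → f (q ⊙ u) ≡ q * f u

  homo : ∀ u q d → f (u ⊕ q ⊙ d) ≡ f u + q * f d
  homo u q d = trans (homo-⊕ u (q ⊙ d)) (cong (λ r → f u + r) (homo-⊙ q d))

eval-isLinear : ∀ i → IsLinear {m} (λ u → u i)
eval-isLinear i = record
  { f-cong = λ u≗d → u≗d i ; homo-⊕ = λ _ _ → refl ; homo-⊙ = λ _ _ → refl }

linComb-isLinear : ∀ (v : Vector (Vector ℚ n) m) j → IsLinear (λ c → linComb c v j)
linComb-isLinear v j = record
  { f-cong = λ u≗d → ∑.sum-cong-≗ λ i → cong (_* v i j) (u≗d i)
  ; homo-⊕ = λ u d → trans
      (∑.sum-cong-≗ λ i → ℚ.*-distribʳ-+ (v i j) (u i) (d i))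
      (∑.∑-distrib-+ (λ i → u i * v i j) (λ i → d i * v i j))
  ; homo-⊙ = λ q u → trans
      (∑.sum-cong-≗ λ i → ℚ.*-assoc q (u i) (v i j))
      (sym (∑.*-distribˡ-sum q (λ i → u i * v i j)))
  }

record IsSubspace (K : Pred (Vector ℚ m) 0ℓ) : Set where
  field
    ⊕-closed : ∀ {u d} → u ∈ K → d ∈ K → (u ⊕ d) ∈ K
    ⊙-closed : ∀ q {u} → u ∈ K → (q ⊙ u) ∈ K

  closed : ∀ {u} q {d} → u ∈ K → d ∈ K → (u ⊕ q ⊙ d) ∈ K
  closed q u∈K d∈K = ⊕-closed u∈K (⊙-closed q d∈K)

Kernel : Vector (Vector ℚ n) m → Pred (Vector ℚ m) 0ℓ
Kernel v c = linComb c v ≗ λ _ → 0ℚ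

kernel-isSubspace : (v : Vector (Vector ℚ n) m) → IsSubspace (Kernel v)
kernel-isSubspace v = record
  { ⊕-closed = λ {u} {d} u∈K d∈K j → trans (homo-⊕ (linear j) u d) (cong₂ _+_ (u∈K j) (d∈K j))
  ; ⊙-closed = λ q {u} u∈K j → trans (homo-⊙ (linear j) q u) (trans (cong (q *_) (u∈K j)) (ℚ.*-zeroʳ q))
  }
  where
  open IsLinear
  linear = linComb-isLinear v

-- A reduced echelon basis: offDiag and diagonal give independence, unique gives
-- spanning, since subtracting Σ u (pivot t) vec t from u ∈ K clears all its pivots.
record Basis (K : Pred (Vector ℚ m) 0ℓ) (k : ℕ) : Set where
  field
    pivot    : Fin k → Fin m
    vec      : Fin k → Vector ℚ m
    vec∈K    : ∀ t → vec t ∈ K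
    diagonal : ∀ t → vec t (pivot t) ≡ 1ℚ
    offDiag  : ∀ {s t} → s ≢ t → vec s (pivot t) ≡ 0ℚ
    unique   : ∀ {u} → u ∈ K → (∀ t → u (pivot t) ≡ 0ℚ) → ∀ i → u i ≡ 0ℚ

open Basis

basis-resp : ∀ {K L : Pred (Vector ℚ m) 0ℓ} → K ⊆ L → L ⊆ K → Basis K k → Basis L k
basis-resp K⊆L L⊆K B = record
  { pivot    = pivot B
  ; vec      = vec B
  ; vec∈K    = λ t → K⊆L (vec∈K B t)
  ; diagonal = diagonal B
  ; offDiag  = offDiag B
  ; unique   = λ u∈L → unique B (L⊆K u∈L)
  }

module _ {K : Pred (Vector ℚ m) 0ℓ} (K-isSubspace : IsSubspace K) where
  open IsSubspace K-isSubspace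

  -- Subtracting `u (pivot B s)` times `vec B s` from `u` clears every pivot, so `unique` makes the
  -- difference zero.
  multiple : ∀ (B : Basis K k) s {u} → u ∈ K → (∀ t → t ≢ s → u (pivot B t) ≡ 0ℚ) →
             ∀ i → u i ≡ u (pivot B s) * vec B s i
  multiple B s {u} u∈K vanish i = p-1q≡0⇒p≡q _ _ (begin
    u i + - 1ℚ * (c * vec B s i)  ≡⟨ solve 3 (λ p c q → p :+ (:- con 1ℚ) :* (c :* q) := p :+ (:- c) :* q) refl (u i) c (vec B s i) ⟩
    u i + - c * vec B s i         ≡⟨ unique B (closed (- c) u∈K (vec∈K B s)) zeros i ⟩
    0ℚ                            ∎)
    where
    open ≡-Reasoning
    c = u (pivot B s)
    zeros : ∀ t → u (pivot B t) + - c * vec B s (pivot B t) ≡ 0ℚ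
    zeros t with t Fin.≟ s
    ... | yes refl = trans (cong (λ r → c + - c * r) (diagonal B s))
                           (solve 1 (λ c → c :+ (:- c) :* con 1ℚ := con 0ℚ) refl c)
    ... | no t≢s   = trans (cong₂ (λ p r → p + - c * r) (vanish t t≢s) (offDiag B (t≢s ∘ sym)))
                           (solve 1 (λ c → con 0ℚ :+ (:- c) :* con 0ℚ := con 0ℚ) refl c)

  -- Gaussian elimination: multiples of `vec B s` bring the other vectors into the zero set of `f`,
  -- and `vec B s` is dropped. The remaining pivots stay reduced because `vec B s` vanishes there. A
  -- `u` that vanishes at all of them is a multiple of `vec B s`, and `f u ≡ 0ℚ` forces the factor
  -- to be zero.
  eliminate : ∀ {f} → IsLinear f → (B : Basis K (suc k)) → ∀ s → f (vec B s) ≢ 0ℚ →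
              Basis (K ∩ λ u → f u ≡ 0ℚ) k
  eliminate {f = f} f-isLinear B s fs≢0 = record
    { pivot    = pivot B ∘ punchIn s
    ; vec      = λ t → vec B (punchIn s t) ⊕ q t ⊙ vec B s
    ; vec∈K    = λ t → closed (q t) (vec∈K B _) (vec∈K B s) , f-vec t
    ; diagonal = λ t → entry t (punchInᵢ≢i s t ∘ sym) (diagonal B _)
    ; offDiag  = λ {r} {t} r≢t →
        entry r (punchInᵢ≢i s t ∘ sym) (offDiag B (r≢t ∘ punchIn-injective s _ _))
    ; unique   = λ { (u∈K , fu≡0) vanish → uniqueness u∈K fu≡0 vanish }
    }
    where
    open ≡-Reasoning
    open IsLinear f-isLinear
    instance _ = ≢-nonZero fs≢0
    q : Fin _ → ℚ
    q t = - (f (vec B (punchIn s t)) * 1/ f (vec B s))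

    f-vec : ∀ t → f (vec B (punchIn s t) ⊕ q t ⊙ vec B s) ≡ 0ℚ
    f-vec t = begin
      f (vec B (punchIn s t) ⊕ q t ⊙ vec B s)  ≡⟨ homo _ (q t) _ ⟩
      y + - (y * 1/ z) * z                     ≡⟨ solve 3 (λ y z⁻¹ z → y :+ (:- (y :* z⁻¹)) :* z := y :+ (:- y) :* (z⁻¹ :* z)) refl y (1/ z) z ⟩
      y + - y * (1/ z * z)                     ≡⟨ cong (λ r → y + - y * r) (ℚ.*-inverseˡ z) ⟩
      y + - y * 1ℚ                             ≡⟨ solve 1 (λ y → y :+ (:- y) :* con 1ℚ := con 0ℚ) refl y ⟩
      0ℚ                                       ∎
      where
      y = f (vec B (punchIn s t))
      z = f (vec B s)

    entry : ∀ r {t p} → s ≢ t → vec B (punchIn s r) (pivot B t) ≡ p →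
            (vec B (punchIn s r) ⊕ q r ⊙ vec B s) (pivot B t) ≡ p
    entry r {p = p} s≢t eq = trans (cong₂ (λ x y → x + q r * y) eq (offDiag B s≢t))
      (solve 2 (λ p q → p :+ q :* con 0ℚ := p) refl p (q r))

    uniqueness : ∀ {u} → u ∈ K → f u ≡ 0ℚ → (∀ t → u (pivot B (punchIn s t)) ≡ 0ℚ) →
                 ∀ i → u i ≡ 0ℚ
    uniqueness {u} u∈K fu≡0 vanish i = begin
      u i               ≡⟨ u≗ i ⟩
      c * vec B s i     ≡⟨ cong (_* vec B s i) c≡0 ⟩
      0ℚ * vec B s i    ≡⟨ ℚ.*-zeroˡ (vec B s i) ⟩
      0ℚ                ∎
      where
      c = u (pivot B s)
      u≗ : u ≗ c ⊙ vec B s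
      u≗ = multiple B s u∈K λ t t≢s →
        subst (λ r → u (pivot B r) ≡ 0ℚ) (punchIn-punchOut (t≢s ∘ sym)) (vanish _)
      c≡0 : c ≡ 0ℚ
      c≡0 = decidable-stable (c ≟ 0ℚ) λ c≢0 →
        *≢0 c≢0 fs≢0 (trans (sym (homo-⊙ c (vec B s))) (trans (sym (f-cong u≗)) fu≡0))

  -- Eliminating with the evaluation at `i` leaves a basis of the vectors of `K` whose entry at `i`
  -- is zero; `vec B s`, rescaled to have entry 1 at `i`, completes it. The new pivot gets index
  -- `zero`.
  exchange : (B : Basis K (suc k)) → ∀ s i → vec B s i ≢ 0ℚ → Basis K (suc k)
  exchange B s i ≢0 = record
    { pivot    = λ { zero → i ; (suc t) → pivot B (punchIn s t) }
    ; vec      = λ { zero → q ⊙ vec B s ; (suc t) → vec E t }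
    ; vec∈K    = λ { zero → ⊙-closed q (vec∈K B s) ; (suc t) → proj₁ (vec∈K E t) }
    ; diagonal = λ { zero → ℚ.*-inverseˡ (vec B s i) ; (suc t) → diagonal E t }
    ; offDiag  = λ { {zero}  {zero}  0≢0 → contradiction refl 0≢0
                   ; {zero}  {suc t} _   → trans (cong (q *_) (offDiag B (punchInᵢ≢i s t ∘ sym))) (ℚ.*-zeroʳ q)
                   ; {suc r} {zero}  _   → proj₂ (vec∈K E r)
                   ; {suc r} {suc t} r≢t → offDiag E (r≢t ∘ cong suc)
                   }
    ; unique   = λ u∈K vanish → unique E (u∈K , vanish zero) (vanish ∘ suc)
    }
    where
    instance _ = ≢-nonZero ≢0
    q = 1/ vec B s i
    E = eliminate (eval-isLinear i) B s ≢0

  -- The pivots of u are cleared one after the other.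
  subring-closed : ∀ (R : Pred ℚ 0ℓ) → 0ℚ ∈ R → (∀ {p q} → p ∈ R → q ∈ R → p + q ∈ R) →
    (∀ {p q} → p ∈ R → q ∈ R → p * q ∈ R) → (∀ {p} → p ∈ R → - p ∈ R) →
    (B : Basis K k) → (∀ t i → vec B t i ∈ R) →
    ∀ {u} → u ∈ K → (∀ t → u (pivot B t) ∈ R) → ∀ i → u i ∈ R
  subring-closed R 0∈R +-closed *-closed -‿closed B vec∈R u∈K pivots∈R =
    go (List.allFin _) u∈K pivots∈R λ t → inj₁ (∈-allFin t)
    where
    go : ∀ (ts : List (Fin _)) {u} → u ∈ K → (∀ t → u (pivot B t) ∈ R) →
         (∀ t → t ∈ₗ ts ⊎ u (pivot B t) ≡ 0ℚ) → ∀ i → u i ∈ R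
    go []       u∈K pivots∈R zeros i =
      subst (_∈ R) (sym (unique B u∈K (λ t → [ (λ ()) , id ]′ (zeros t)) i)) 0∈R
    go (s ∷ ts) {u} u∈K pivots∈R zeros i =
      subst (_∈ R) (solve 3 (λ p c q → p :+ (:- c) :* q :+ c :* q := p) refl (u i) c (vec B s i))
        (+-closed
          (go ts (closed (- c) u∈K (vec∈K B s))
            (λ t → +-closed (pivots∈R t) (*-closed (-‿closed c∈R) (vec∈R s (pivot B t))))
            zeros′ i)
          (*-closed c∈R (vec∈R s i)))
      where
      c = u (pivot B s)
      c∈R = pivots∈R s
      zeros′ : ∀ t → t ∈ₗ ts ⊎ u (pivot B t) + - c * vec B s (pivot B t) ≡ 0ℚ
      zeros′ t with t Fin.≟ s
      ... | yes refl = inj₂ (trans (cong (λ r → c + - c * r) (diagonal B s))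
                              (solve 1 (λ c → c :+ (:- c) :* con 1ℚ := con 0ℚ) refl c))
      ... | no t≢s with zeros t
      ...   | inj₁ (here t≡s)   = contradiction t≡s t≢s
      ...   | inj₁ (there t∈ts) = inj₁ t∈ts
      ...   | inj₂ ut≡0         = inj₂ (trans (cong₂ (λ p r → p + - c * r) ut≡0 (offDiag B (t≢s ∘ sym)))
                              (solve 1 (λ c → con 0ℚ :+ (:- c) :* con 0ℚ := con 0ℚ) refl c))

-- Induction on the number of coordinates: with none, the kernel is the whole space and the unit
-- vectors serve; each further coordinate imposes one linear equation `f`.
kernelBasis : ∀ n (v : Vector (Vector ℚ n) m) → ∃ (Basis (Kernel v))
kernelBasis {m} zero v = m , record
  { pivot    = id
  ; vec      = λ s → updateAt (replicate m 0ℚ) s (λ _ → 1ℚ)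
  ; vec∈K    = λ _ ()
  ; diagonal = λ s → updateAt-updates s (replicate m 0ℚ)
  ; offDiag  = λ {s} {t} s≢t → updateAt-minimal t s (replicate m 0ℚ) (s≢t ∘ sym)
  ; unique   = λ _ vanish → vanish
  }
kernelBasis {m} (suc n) v = addRow (kernelBasis n tails)
  where
  tails : Vector (Vector ℚ n) m
  tails i = v i ∘ suc

  f : Vector ℚ m → ℚ
  f c = linComb c v zero

  addRow : ∃ (Basis (Kernel tails)) → ∃ (Basis (Kernel v))
  addRow (k , B) with Fin.any? (λ s → ¬? (f (vec B s) ≟ 0ℚ))
  addRow (suc k , B) | yes (s , fs≢0) = k , basis-resp
    (λ { (u∈K , fu≡0) zero → fu≡0 ; (u∈K , fu≡0) (suc j) → u∈K j })
    (λ u∈K → u∈K ∘ suc , u∈K zero)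
    (eliminate (kernel-isSubspace tails) (linComb-isLinear v zero) B s fs≢0)
  -- Here `f` vanishes on every basis vector, so the vectors already lie in the smaller kernel, and
  -- `unique` is inherited from the larger one.
  addRow (k , B)     | no none = k , record
    { pivot    = pivot B
    ; vec      = vec B
    ; vec∈K    = λ { s zero → decidable-stable (_ ≟ 0ℚ) (λ fs≢0 → none (s , fs≢0))
                   ; s (suc j) → vec∈K B s j }
    ; diagonal = diagonal B
    ; offDiag  = offDiag B
    ; unique   = λ u∈K → unique B (u∈K ∘ suc)
    }

-- Integers as rationals

-- `i / 1` is normalised by a gcd and does not compute for a variable `i`. Identities are therefore
-- checked on unnormalised fractions; the `0` in `mkℚᵘ i 0` encodes the denominator 1.
toℚᵘ-fromℤ : ∀ i → toℚᵘ (fromℤ i) ℚᵘ.≃ mkℚᵘ i 0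
toℚᵘ-fromℤ i = ℚ.toℚᵘ-fromℚᵘ (mkℚᵘ i 0)

fromℤ-injective : ∀ {i j} → fromℤ i ≡ fromℤ j → i ≡ j
fromℤ-injective {i} {j} eq with *≡* i*1≡j*1 ← ℚ./-injective-≃ (mkℚᵘ i 0) (mkℚᵘ j 0) eq =
  ℤ.*-cancelʳ-≡ i j 1ℤ i*1≡j*1

fromℤ-homo-+ : ∀ i j → fromℤ (i ℤ.+ j) ≡ fromℤ i + fromℤ j
fromℤ-homo-+ i j = ℚ.toℚᵘ-injective (begin-equality
  toℚᵘ (fromℤ (i ℤ.+ j))             ≃⟨ toℚᵘ-fromℤ (i ℤ.+ j) ⟩
  mkℚᵘ (i ℤ.+ j) 0                   ≃⟨ *≡* (cong (ℤ._* 1ℤ) (sym (cong₂ ℤ._+_ (ℤ.*-identityʳ i) (ℤ.*-identityʳ j)))) ⟩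
  mkℚᵘ i 0 ℚᵘ.+ mkℚᵘ j 0             ≃⟨ ℚᵘ.+-cong (toℚᵘ-fromℤ i) (toℚᵘ-fromℤ j) ⟨
  toℚᵘ (fromℤ i) ℚᵘ.+ toℚᵘ (fromℤ j) ≃⟨ ℚ.toℚᵘ-homo-+ (fromℤ i) (fromℤ j) ⟨
  toℚᵘ (fromℤ i + fromℤ j)           ∎)
  where open ℚᵘ.≤-Reasoning

fromℤ-homo-* : ∀ i j → fromℤ (i ℤ.* j) ≡ fromℤ i * fromℤ j
fromℤ-homo-* i j = ℚ.toℚᵘ-injective (begin-equality
  toℚᵘ (fromℤ (i ℤ.* j))             ≃⟨ toℚᵘ-fromℤ (i ℤ.* j) ⟩
  mkℚᵘ i 0 ℚᵘ.* mkℚᵘ j 0             ≃⟨ ℚᵘ.*-cong (toℚᵘ-fromℤ i) (toℚᵘ-fromℤ j) ⟨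
  toℚᵘ (fromℤ i) ℚᵘ.* toℚᵘ (fromℤ j) ≃⟨ ℚ.toℚᵘ-homo-* (fromℤ i) (fromℤ j) ⟨
  toℚᵘ (fromℤ i * fromℤ j)           ∎)
  where open ℚᵘ.≤-Reasoning

/-*-cancel : ∀ i b .{{_ : ℕ.NonZero b}} → i / b * fromℤ (+ b) ≡ fromℤ i
/-*-cancel i b@(suc b-1) = ℚ.toℚᵘ-injective (begin-equality
  toℚᵘ (i / b * fromℤ (+ b))             ≃⟨ ℚ.toℚᵘ-homo-* (i / b) (fromℤ (+ b)) ⟩
  toℚᵘ (i / b) ℚᵘ.* toℚᵘ (fromℤ (+ b))   ≃⟨ ℚᵘ.*-cong (ℚ.toℚᵘ-fromℚᵘ (mkℚᵘ i b-1)) (toℚᵘ-fromℤ (+ b)) ⟩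
  mkℚᵘ i b-1 ℚᵘ.* mkℚᵘ (+ b) 0           ≃⟨ *≡* (ℤ.*-assoc i (+ b) 1ℤ) ⟩
  mkℚᵘ i 0                               ≃⟨ toℚᵘ-fromℤ i ⟨
  toℚᵘ (fromℤ i)                         ∎)
  where open ℚᵘ.≤-Reasoning

fromℤ-pos≢0 : ∀ b .{{_ : ℕ.NonZero b}} → fromℤ (+ b) ≢ 0ℚ
fromℤ-pos≢0 (suc b-1) eq with () ← fromℤ-injective {+ suc b-1} {0ℤ} eq

fromℤ-pos-* : ∀ b c → fromℤ (+ (b ℕ.* c)) ≡ fromℤ (+ b) * fromℤ (+ c)
fromℤ-pos-* b c = trans (cong fromℤ (ℤ.pos-* b c)) (fromℤ-homo-* (+ b) (+ c))

-- Fractions with denominators supported on P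

Smooth : Pred ℕ 0ℓ → Pred ℕ 0ℓ
Smooth P b = ∀ p → Prime p → p ∣ b → p ∈ P

module _ {P : Pred ℕ 0ℓ} where

  smooth-* : ∀ {b c} → Smooth P b → Smooth P c → Smooth P (b ℕ.* c)
  smooth-* {b} {c} sb sc p p-prime p∣bc =
    [ sb p p-prime , sc p p-prime ]′ (euclidsLemma b c p-prime p∣bc)

  -- Membership is certified by an equation free of division, so the closure proofs below reduce to
  -- integer arithmetic.
  integral⇒∈ : ∀ {q} a b .{{_ : ℕ.NonZero b}} → Smooth P b →
               q * fromℤ (+ b) ≡ fromℤ a → q ∈ ℚ[ P ]
  integral⇒∈ a b@(suc _) sb eq = a , b , _ , sb ,
    *-cancelʳ (fromℤ (+ b)) (fromℤ-pos≢0 b) (trans eq (sym (/-*-cancel a b)))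

  fromℤ∈ : ∀ i → fromℤ i ∈ ℚ[ P ]
  fromℤ∈ i = integral⇒∈ i 1
    (λ p p-prime p∣1 → contradiction (subst Prime (ℕ.∣1⇒≡1 p∣1) p-prime) ¬prime[1])
    (ℚ.*-identityʳ (fromℤ i))

  ∈-+ : ∀ {p q} → p ∈ ℚ[ P ] → q ∈ ℚ[ P ] → p + q ∈ ℚ[ P ]
  ∈-+ (a , b , b≢0 , sb , refl) (c , d , d≢0 , sd , refl) =
    integral⇒∈ (a ℤ.* + d ℤ.+ c ℤ.* + b) (b ℕ.* d) (smooth-* sb sd) (begin
      (x + y) * fromℤ (+ (b ℕ.* d))  ≡⟨ cong ((x + y) *_) (fromℤ-pos-* b d) ⟩
      (x + y) * (β * δ)              ≡⟨ solve 4 (λ x y β δ → (x :+ y) :* (β :* δ) := (x :* β) :* δ :+ (y :* δ) :* β) refl x y β δ ⟩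
      (x * β) * δ + (y * δ) * β      ≡⟨ cong₂ (λ s t → s * δ + t * β) (/-*-cancel a b) (/-*-cancel c d) ⟩
      fromℤ a * δ + fromℤ c * β      ≡⟨ cong₂ _+_ (fromℤ-homo-* a (+ d)) (fromℤ-homo-* c (+ b)) ⟨
      fromℤ (a ℤ.* + d) + fromℤ (c ℤ.* + b)  ≡⟨ fromℤ-homo-+ (a ℤ.* + d) (c ℤ.* + b) ⟨
      fromℤ (a ℤ.* + d ℤ.+ c ℤ.* + b)        ∎)
    where
    open ≡-Reasoning
    instance
      _ = b≢0
      _ = d≢0
      _ = ℕ.m*n≢0 b d
    x = a / b
    y = c / d
    β = fromℤ (+ b)
    δ = fromℤ (+ d)

  ∈-* : ∀ {p q} → p ∈ ℚ[ P ] → q ∈ ℚ[ P ] → p * q ∈ ℚ[ P ]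
  ∈-* (a , b , b≢0 , sb , refl) (c , d , d≢0 , sd , refl) =
    integral⇒∈ (a ℤ.* c) (b ℕ.* d) (smooth-* sb sd) (begin
      x * y * fromℤ (+ (b ℕ.* d))  ≡⟨ cong (x * y *_) (fromℤ-pos-* b d) ⟩
      x * y * (β * δ)              ≡⟨ solve 4 (λ x y β δ → x :* y :* (β :* δ) := (x :* β) :* (y :* δ)) refl x y β δ ⟩
      (x * β) * (y * δ)            ≡⟨ cong₂ _*_ (/-*-cancel a b) (/-*-cancel c d) ⟩
      fromℤ a * fromℤ c            ≡⟨ fromℤ-homo-* a c ⟨
      fromℤ (a ℤ.* c)              ∎)
    where
    open ≡-Reasoning
    instance
      _ = b≢0
      _ = d≢0
      _ = ℕ.m*n≢0 b d
    x = a / b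
    y = c / d
    β = fromℤ (+ b)
    δ = fromℤ (+ d)

  ∈-neg : ∀ {p} → p ∈ ℚ[ P ] → - p ∈ ℚ[ P ]
  ∈-neg {p} p∈ = subst (_∈ ℚ[ P ])
    (solve 1 (λ p → (:- con 1ℚ) :* p := :- p) refl p)
    (∈-* (fromℤ∈ (ℤ.- 1ℤ)) p∈)

-- Primitive integer multiples

-- The product of the reduced denominators is a common denominator, not necessarily the least;
-- `primitiveMultiple` removes any common factor of the numerators.
clearDenominators : (d : Vector ℚ m) →
  Σ[ a ∈ Vector ℤ _ ] Σ[ b ∈ ℕ ] ℕ.NonZero b × (∀ i → d i * fromℤ (+ b) ≡ fromℤ (a i))
clearDenominators {zero}  d = (λ ()) , 1 , _ , λ ()
clearDenominators {suc m} d with a , b , b≢0 , db≡a ← clearDenominators (d ∘ suc) =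
  a′ , c ℕ.* b , ℕ.m*n≢0 c b {{_}} {{b≢0}} , eq
  where
  open ≡-Reasoning
  c = ↧ₙ d zero
  a′ : Vector ℤ (suc m)
  a′ zero    = ↥ d zero ℤ.* + b
  a′ (suc i) = a i ℤ.* + c
  eq : ∀ i → d i * fromℤ (+ (c ℕ.* b)) ≡ fromℤ (a′ i)
  eq zero = begin
    d zero * fromℤ (+ (c ℕ.* b))            ≡⟨ cong (d zero *_) (fromℤ-pos-* c b) ⟩
    d zero * (fromℤ (+ c) * fromℤ (+ b))    ≡⟨ ℚ.*-assoc (d zero) (fromℤ (+ c)) (fromℤ (+ b)) ⟨
    d zero * fromℤ (+ c) * fromℤ (+ b)      ≡⟨ cong (λ r → r * fromℤ (+ c) * fromℤ (+ b)) (ℚ.↥p/↧p≡p (d zero)) ⟨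
    ↥ d zero / c * fromℤ (+ c) * fromℤ (+ b)  ≡⟨ cong (_* fromℤ (+ b)) (/-*-cancel (↥ d zero) c) ⟩
    fromℤ (↥ d zero) * fromℤ (+ b)          ≡⟨ fromℤ-homo-* (↥ d zero) (+ b) ⟨
    fromℤ (↥ d zero ℤ.* + b)                ∎
  eq (suc i) = begin
    x * fromℤ (+ (c ℕ.* b))          ≡⟨ cong (x *_) (fromℤ-pos-* c b) ⟩
    x * (fromℤ (+ c) * fromℤ (+ b))  ≡⟨ solve 3 (λ x c b → x :* (c :* b) := x :* b :* c) refl x (fromℤ (+ c)) (fromℤ (+ b)) ⟩
    x * fromℤ (+ b) * fromℤ (+ c)    ≡⟨ cong (_* fromℤ (+ c)) (db≡a i) ⟩
    fromℤ (a i) * fromℤ (+ c)        ≡⟨ fromℤ-homo-* (a i) (+ c) ⟨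
    fromℤ (a i ℤ.* + c)              ∎
    where x = d (suc i)

gcdᵥ : Vector ℤ m → ℤ
gcdᵥ = foldr ℤ.gcd 0ℤ

gcdᵥ∣ : ∀ (a : Vector ℤ m) i → gcdᵥ a ∣ℤ a i
gcdᵥ∣ a zero    = ℤ.gcd[i,j]∣i (a zero) (gcdᵥ (a ∘ suc))
gcdᵥ∣ a (suc i) = ℕ.∣-trans (ℤ.gcd[i,j]∣j (a zero) (gcdᵥ (a ∘ suc))) (gcdᵥ∣ (a ∘ suc) i)

gcdᵥ-greatest : ∀ (a : Vector ℤ m) {c} → (∀ i → c ∣ℤ a i) → c ∣ℤ gcdᵥ a
gcdᵥ-greatest {zero}  a {c} c∣a = ℤ.∣ c ∣ ℕ.∣0
gcdᵥ-greatest {suc m} a {c} c∣a =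
  ℤ.gcd-greatest {a zero} {gcdᵥ (a ∘ suc)} {c} (c∣a zero) (gcdᵥ-greatest (a ∘ suc) {c} (c∣a ∘ suc))

-- Both cases of the fold yield `+` of a natural number, so taking the absolute value loses no sign.
+∣gcdᵥ∣ : ∀ (a : Vector ℤ m) → + ℤ.∣ gcdᵥ a ∣ ≡ gcdᵥ a
+∣gcdᵥ∣ {zero}  a = refl
+∣gcdᵥ∣ {suc m} a = refl

-- The entry 1 at `j` makes the multiplier `b` equal to `a j`. The gcd of the numerators thus
-- divides `b` as well, and dividing both by it keeps the multiplier a natural number.
primitiveMultiple : (d : Vector ℚ m) → ∀ j → d j ≡ 1ℚ →
  Σ[ a ∈ Vector ℤ _ ] Σ[ b ∈ ℕ ] ℕ.NonZero b × (∀ i → d i * fromℤ (+ b) ≡ fromℤ (a i)) × gcdᵥ a ≡ 1ℤ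
primitiveMultiple d j dj≡1 with a , b , b≢0 , db≡a ← clearDenominators d =
  a′ , b′ , ℕ.≢-nonZero b′≢0 , db′≡a′ , gcdᵥa′≡1
  where
  open ≡-Reasoning
  g = ℤ.∣ gcdᵥ a ∣

  a′ : Vector ℤ _
  a′ i = Signed.quotient (Signed.∣ᵤ⇒∣ {gcdᵥ a} {a i} (gcdᵥ∣ a i))

  a≡a′g : ∀ i → a i ≡ a′ i ℤ.* + g
  a≡a′g i = trans (Signed._∣_.equality (Signed.∣ᵤ⇒∣ {gcdᵥ a} {a i} (gcdᵥ∣ a i)))
                  (cong (a′ i ℤ.*_) (sym (+∣gcdᵥ∣ a)))

  +b≡aj : + b ≡ a j
  +b≡aj = fromℤ-injective (begin
    fromℤ (+ b)         ≡⟨ ℚ.*-identityˡ (fromℤ (+ b)) ⟨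
    1ℚ * fromℤ (+ b)    ≡⟨ cong (_* fromℤ (+ b)) dj≡1 ⟨
    d j * fromℤ (+ b)   ≡⟨ db≡a j ⟩
    fromℤ (a j)         ∎)

  g∣b : g ∣ b
  g∣b = subst (λ z → gcdᵥ a ∣ℤ z) (sym +b≡aj) (gcdᵥ∣ a j)
  b′ = ℕ.quotient g∣b
  b≡b′g : b ≡ b′ ℕ.* g
  b≡b′g = ℕ._∣_.equality g∣b

  b≢0′ : b ≢ 0
  b≢0′ = ℕ.≢-nonZero⁻¹ b {{b≢0}}
  b′≢0 : b′ ≢ 0
  b′≢0 b′≡0 = b≢0′ (trans b≡b′g (cong (ℕ._* g) b′≡0))
  g≢0 : g ≢ 0
  g≢0 g≡0 = b≢0′ (trans b≡b′g (trans (cong (b′ ℕ.*_) g≡0) (ℕ.*-zeroʳ b′)))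
  instance _ = ℕ.≢-nonZero g≢0

  db′≡a′ : ∀ i → d i * fromℤ (+ b′) ≡ fromℤ (a′ i)
  db′≡a′ i = *-cancelʳ (fromℤ (+ g)) (fromℤ-pos≢0 g) (begin
    d i * fromℤ (+ b′) * fromℤ (+ g)     ≡⟨ ℚ.*-assoc (d i) (fromℤ (+ b′)) (fromℤ (+ g)) ⟩
    d i * (fromℤ (+ b′) * fromℤ (+ g))   ≡⟨ cong (d i *_) (fromℤ-pos-* b′ g) ⟨
    d i * fromℤ (+ (b′ ℕ.* g))           ≡⟨ cong (λ z → d i * fromℤ (+ z)) b≡b′g ⟨
    d i * fromℤ (+ b)                    ≡⟨ db≡a i ⟩
    fromℤ (a i)                          ≡⟨ cong fromℤ (a≡a′g i) ⟩
    fromℤ (a′ i ℤ.* + g)                 ≡⟨ fromℤ-homo-* (a′ i) (+ g) ⟩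
    fromℤ (a′ i) * fromℤ (+ g)           ∎)

  g′ = gcdᵥ a′
  -- `g′` times `g` divides every `a i`, hence also their gcd, which is `g`; cancelling `g` leaves
  -- `g′` dividing 1.
  g′g∣1g : g′ ℤ.* + g ∣ℤ 1ℤ ℤ.* + g
  g′g∣1g = subst (λ z → g′ ℤ.* + g ∣ℤ z) (trans (sym (+∣gcdᵥ∣ a)) (sym (ℤ.*-identityˡ (+ g))))
    (gcdᵥ-greatest a {g′ ℤ.* + g} λ i → subst (λ z → g′ ℤ.* + g ∣ℤ z) (sym (a≡a′g i))
      (ℤ.*-monoˡ-∣ (+ g) {g′} {a′ i} (gcdᵥ∣ a′ i)))

  gcdᵥa′≡1 : g′ ≡ 1ℤ
  gcdᵥa′≡1 = trans (sym (+∣gcdᵥ∣ a′))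
    (cong +_ (ℕ.∣1⇒≡1 (ℤ.*-cancelʳ-∣ (+ g) {g′} {1ℤ} g′g∣1g)))

∈⇒∣product : ∀ {i} (is : List ℤ) → i ∈ₗ is → i ∣ℤ List.foldr ℤ._*_ 1ℤ is
∈⇒∣product {i} (j ∷ is) i∈j∷is = subst (ℤ.∣ i ∣ ∣_) (sym (ℤ.abs-* j _)) (case i∈j∷is of λ
  { (here refl)  → ℕ.m∣m*n _
  ; (there i∈is) → ℕ.∣n⇒∣m*n ℤ.∣ j ∣ (∈⇒∣product is i∈is)
  })

∣nonzeroProduct : ∀ (a : Vector ℤ m) i → a i ≢ 0ℤ → a i ∣ℤ nonzeroProduct a
∣nonzeroProduct a i ai≢0 =
  ∈⇒∣product _ (∈-filter⁺ (λ j → ¬? (j ℤ.≟ 0ℤ)) (∈-tabulate⁺ i) ai≢0)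

-- Bases of the kernel consist of multiples of elementary relations

module _ (v : Vector (Vector ℚ n) m) (B : Basis (Kernel v) k) where

  private
    P = relationPrimes v

  -- A relation supported inside `vec B s` vanishes at all other pivots, so it is a multiple of
  -- `vec B s`; being nontrivial, it is a nonzero multiple and has the same support.
  vec-minimalSupport : ∀ s {c} → IsNontrivialRelation v c → support c ⊆ support (vec B s) →
                       support (vec B s) ⊆ support c
  vec-minimalSupport s {c} c-isRelation c⊆ {i} si≢0 ci≡0 =
    *≢0 cs≢0 si≢0 (trans (sym (c≗ i)) ci≡0)
    where
    open IsNontrivialRelation c-isRelation
    c≗ : ∀ i → c i ≡ c (pivot B s) * vec B s i
    c≗ = multiple (kernel-isSubspace v) B s relation λ t t≢s →
      decidable-stable (_ ≟ 0ℚ) λ ct≢0 → c⊆ ct≢0 (offDiag B (t≢s ∘ sym))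
    cs≢0 : c (pivot B s) ≢ 0ℚ
    cs≢0 cs≡0 with j , cj≢0 ← nontrivial =
      cj≢0 (trans (c≗ j) (trans (cong (_* vec B s j) cs≡0) (ℚ.*-zeroˡ (vec B s j))))

  -- Since `vec B s` is 1 at its pivot, `b` is itself the coefficient of `a` there. As `a` is an
  -- elementary integral relation, every prime factor of `b` divides its product of nonzero
  -- coefficients.
  denominator-smooth : ∀ s (a : Vector ℤ m) b .{{_ : ℕ.NonZero b}} →
    (∀ i → vec B s i * fromℤ (+ b) ≡ fromℤ (a i)) → gcdᵥ a ≡ 1ℤ → Smooth P b
  denominator-smooth s a b db≡a gcd≡1 p p-prime p∣b =
    p-prime , a , elementary , ℕ.∣-trans p∣b b∣nonzeroProduct
    where
    open ≡-Reasoning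
    d = vec B s
    β = fromℤ (+ b)
    β≢0 = fromℤ-pos≢0 b

    as≡β : fromℤ (a (pivot B s)) ≡ β
    as≡β = trans (sym (db≡a (pivot B s)))
      (trans (cong (_* β) (diagonal B s)) (ℚ.*-identityˡ β))

    support-a⊆d : support (map fromℤ a) ⊆ support d
    support-a⊆d {j} aj≢0 dj≡0 = aj≢0
      (trans (sym (db≡a j)) (trans (cong (_* β) dj≡0) (ℚ.*-zeroˡ β)))

    a∈Kernel : map fromℤ a ∈ Kernel v
    a∈Kernel j = begin
      linComb (map fromℤ a) v j  ≡⟨ f-cong (λ i → trans (sym (db≡a i)) (ℚ.*-comm (d i) β)) ⟩
      linComb (β ⊙ d) v j        ≡⟨ homo-⊙ β d ⟩
      β * linComb d v j          ≡⟨ cong (β *_) (vec∈K B s j) ⟩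
      β * 0ℚ                     ≡⟨ ℚ.*-zeroʳ β ⟩
      0ℚ                         ∎
      where open IsLinear (linComb-isLinear v j)

    elementary : IsElementaryIntegralRelation v a
    elementary = record
      { isNontrivialRelation = record
          { relation   = a∈Kernel
          ; nontrivial = pivot B s , λ as≡0 → β≢0 (trans (sym as≡β) as≡0)
          }
      ; minimalSupport = λ c c-isRelation c⊆a {j} aj≢0 →
          vec-minimalSupport s c-isRelation (λ {j} cj≢0 → support-a⊆d {j} (c⊆a cj≢0)) (support-a⊆d {j} aj≢0)
      ; gcd≡1 = gcd≡1
      }

    as≡b : a (pivot B s) ≡ + b
    as≡b = fromℤ-injective as≡β

    b∣nonzeroProduct : + b ∣ℤ nonzeroProduct a
    b∣nonzeroProduct = subst (λ z → z ∣ℤ nonzeroProduct a) as≡b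
      (∣nonzeroProduct a (pivot B s) λ as≡0 → β≢0 (trans (sym as≡β) (cong fromℤ as≡0)))

  vec∈ℚ[P] : ∀ s i → vec B s i ∈ ℚ[ P ]
  vec∈ℚ[P] s i = case primitiveMultiple (vec B s) (pivot B s) (diagonal B s) of λ
    { (a , b , b≢0 , db≡a , gcd≡1) →
        integral⇒∈ (a i) b {{b≢0}} (denominator-smooth s a b {{b≢0}} db≡a gcd≡1) (db≡a i) }

-- Moving inside a box until a new bound is attained

Within : ℚ → ℚ → Pred ℚ 0ℓ
Within a b x = a ≤ x × x ≤ b

AtBound : ℚ → ℚ → Pred ℚ 0ℓ
AtBound a b x = x ≡ a ⊎ x ≡ b

-- Containment is recorded for all times up to `τ`, because the recursion keeps the smaller of two
-- times, and the coordinate with the later hit must be in bounds then. The condition `d i ≢ 0ℚ` is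
-- what permits exchanging `i` for a pivot.
FirstHit : (a b x d : Vector ℚ m) → Set
FirstHit a b x d = ∃[ τ ] 0ℚ ≤ τ
  × (∀ σ → 0ℚ ≤ σ → σ ≤ τ → ∀ i → Within (a i) (b i) (x i + σ * d i))
  × ∃[ i ] d i ≢ 0ℚ × AtBound (a i) (b i) (x i + τ * d i)

x≡x+σd : ∀ {x} σ {d} → d ≡ 0ℚ → x ≡ x + σ * d
x≡x+σd {x} σ refl = solve 2 (λ x σ → x := x :+ σ :* con 0ℚ) refl x σ

x+[e-x]/d*d≡e : ∀ x e d .{{_ : NonZero d}} → x + (e - x) * 1/ d * d ≡ e
x+[e-x]/d*d≡e x e d = begin
  x + (e - x) * 1/ d * d    ≡⟨ cong (λ r → x + r) (ℚ.*-assoc (e - x) (1/ d) d) ⟩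
  x + (e - x) * (1/ d * d)  ≡⟨ cong (λ r → x + (e - x) * r) (ℚ.*-inverseˡ d) ⟩
  x + (e - x) * 1ℚ          ≡⟨ solve 2 (λ x e → x :+ (e :+ (:- x)) :* con 1ℚ := e) refl x e ⟩
  e                         ∎
  where open ≡-Reasoning

-- The sign of `d` decides which bound is approached: `b` when `d` is positive, `a` when it is
-- negative. Monotonicity in the time gives containment before the hit.
firstHit₁ : ∀ {a b x d} → Within a b x → d ≢ 0ℚ →
  ∃[ τ ] 0ℚ ≤ τ × (∀ σ → 0ℚ ≤ σ → σ ≤ τ → Within a b (x + σ * d)) × AtBound a b (x + τ * d)
firstHit₁ {a} {b} {x} {d} (a≤x , x≤b) d≢0 with ℚ.<-cmp d 0ℚ | solve 2 (λ x d → x :+ con 0ℚ :* d := x) refl x d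
... | tri≈ _ d≡0 _ | _ = contradiction d≡0 d≢0
... | tri> _ _ d>0 | x+0*d≡x = τ , 0≤τ , within , inj₂ hit
  where
  open ℚ.≤-Reasoning
  instance
    _ = positive d>0
    _ = ℚ.pos⇒nonNeg d
    _ = ℚ.pos⇒nonZero d
    _ = ℚ.1/pos⇒pos d
    _ = ℚ.pos⇒nonNeg (1/ d)
  τ = (b - x) * 1/ d
  hit : x + τ * d ≡ b
  hit = x+[e-x]/d*d≡e x b d
  0≤τ : 0ℚ ≤ τ
  0≤τ = begin
    0ℚ              ≡⟨ ℚ.*-zeroˡ (1/ d) ⟨
    0ℚ * 1/ d       ≡⟨ cong (_* 1/ d) (ℚ.+-inverseʳ x) ⟨
    (x - x) * 1/ d  ≤⟨ ℚ.*-monoʳ-≤-nonNeg (1/ d) (ℚ.+-monoˡ-≤ (- x) x≤b) ⟩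
    (b - x) * 1/ d  ∎
  within : ∀ σ → 0ℚ ≤ σ → σ ≤ τ → Within a b (x + σ * d)
  within σ 0≤σ σ≤τ =
    (begin
      a           ≤⟨ a≤x ⟩
      x           ≡⟨ x+0*d≡x ⟨
      x + 0ℚ * d  ≤⟨ ℚ.+-monoʳ-≤ x (ℚ.*-monoʳ-≤-nonNeg d 0≤σ) ⟩
      x + σ * d   ∎) ,
    (begin
      x + σ * d   ≤⟨ ℚ.+-monoʳ-≤ x (ℚ.*-monoʳ-≤-nonNeg d σ≤τ) ⟩
      x + τ * d   ≡⟨ hit ⟩
      b           ∎)
... | tri< d<0 _ _ | x+0*d≡x = τ , 0≤τ , within , inj₁ hit
  where
  open ℚ.≤-Reasoning
  instance
    _ = negative d<0
    _ = ℚ.neg⇒nonPos d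
    _ = ℚ.neg⇒nonZero d
    _ = ℚ.1/neg⇒neg d
    _ = ℚ.neg⇒nonPos (1/ d)
  τ = (a - x) * 1/ d
  hit : x + τ * d ≡ a
  hit = x+[e-x]/d*d≡e x a d
  0≤τ : 0ℚ ≤ τ
  0≤τ = begin
    0ℚ              ≡⟨ ℚ.*-zeroˡ (1/ d) ⟨
    0ℚ * 1/ d       ≡⟨ cong (_* 1/ d) (ℚ.+-inverseʳ x) ⟨
    (x - x) * 1/ d  ≤⟨ ℚ.*-monoʳ-≤-nonPos (1/ d) (ℚ.+-monoˡ-≤ (- x) a≤x) ⟩
    (a - x) * 1/ d  ∎
  within : ∀ σ → 0ℚ ≤ σ → σ ≤ τ → Within a b (x + σ * d)
  within σ 0≤σ σ≤τ =
    (begin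
      a           ≡⟨ hit ⟨
      x + τ * d   ≤⟨ ℚ.+-monoʳ-≤ x (ℚ.*-monoʳ-≤-nonPos d σ≤τ) ⟩
      x + σ * d   ∎) ,
    (begin
      x + σ * d   ≤⟨ ℚ.+-monoʳ-≤ x (ℚ.*-monoʳ-≤-nonPos d 0≤σ) ⟩
      x + 0ℚ * d  ≡⟨ x+0*d≡x ⟩
      x           ≤⟨ x≤b ⟩
      b           ∎)

firstHit : (a b x d : Vector ℚ m) → (∀ i → Within (a i) (b i) (x i)) →
           (∀ i → d i ≡ 0ℚ) ⊎ FirstHit a b x d
firstHit {zero}  a b x d inBox = inj₁ λ ()
firstHit {suc m} a b x d inBox
  with d zero ≟ 0ℚ | firstHit (a ∘ suc) (b ∘ suc) (x ∘ suc) (d ∘ suc) (inBox ∘ suc)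
... | yes d₀≡0 | inj₁ d≡0 = inj₁ λ { zero → d₀≡0 ; (suc i) → d≡0 i }
... | yes d₀≡0 | inj₂ (τ , 0≤τ , within , i , di≢0 , hit) = inj₂
  (τ , 0≤τ
  , (λ { σ 0≤σ σ≤τ zero    → subst (Within _ _) (x≡x+σd σ d₀≡0) (inBox zero)
       ; σ 0≤σ σ≤τ (suc j) → within σ 0≤σ σ≤τ j })
  , suc i , di≢0 , hit)
... | no d₀≢0  | inj₁ d≡0 with τ , 0≤τ , within , hit ← firstHit₁ (inBox zero) d₀≢0 = inj₂
  (τ , 0≤τ
  , (λ { σ 0≤σ σ≤τ zero    → within σ 0≤σ σ≤τ
       ; σ 0≤σ σ≤τ (suc j) → subst (Within _ _) (x≡x+σd σ (d≡0 j)) (inBox (suc j)) })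
  , zero , d₀≢0 , hit)
-- Both the head and the tail move; the earlier of their two hits comes first overall.
... | no d₀≢0  | inj₂ (τ , 0≤τ , within , i , di≢0 , hit)
  with τ₀ , 0≤τ₀ , within₀ , hit₀ ← firstHit₁ (inBox zero) d₀≢0 | ℚ.≤-total τ₀ τ
...   | inj₁ τ₀≤τ = inj₂
  (τ₀ , 0≤τ₀
  , (λ { σ 0≤σ σ≤τ₀ zero    → within₀ σ 0≤σ σ≤τ₀
       ; σ 0≤σ σ≤τ₀ (suc j) → within σ 0≤σ (ℚ.≤-trans σ≤τ₀ τ₀≤τ) j })
  , zero , d₀≢0 , hit₀)
...   | inj₂ τ≤τ₀ = inj₂
  (τ , 0≤τ
  , (λ { σ 0≤σ σ≤τ zero    → within₀ σ 0≤σ (ℚ.≤-trans σ≤τ τ≤τ₀)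
       ; σ 0≤σ σ≤τ (suc j) → within σ 0≤σ σ≤τ j })
  , suc i , di≢0 , hit)

-- Vertices of the polytope of feasible points

toℕ-punchIn-fromℕ : ∀ (t : Fin k) → toℕ (punchIn (fromℕ k) t) ≡ toℕ t
toℕ-punchIn-fromℕ zero    = refl
toℕ-punchIn-fromℕ (suc t) = cong suc (toℕ-punchIn-fromℕ t)

module _ (v : Vector (Vector ℚ n) m) (a b : Vector ℚ m) (w : Vector ℚ n) where

  record Feasible (x : Vector ℚ m) : Set where
    field
      inBox : ∀ i → Within (a i) (b i) (x i)
      sums  : w ≗ linComb x v

  open Feasible

  -- `k` stays fixed while `l` counts the leading pivots known to sit at a bound; the point and the
  -- basis both change from one `l` to the next.
  Tightened : ℕ → ℕ → Set
  Tightened k l = ∃[ x ] Feasible x × Σ[ B ∈ Basis (Kernel v) k ]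
    (∀ t → toℕ t ℕ.< l → AtBound (a (pivot B t)) (b (pivot B t)) (x (pivot B t)))

  -- The last basis vector is exchanged and moved to the front, which keeps the
  -- pivots already at a bound in initial position.
  tightenOnce : ∀ {l} → Tightened (suc k) l → Tightened (suc k) (suc l)
  tightenOnce {k} (x , x-feasible , B , tight)
    with firstHit a b x (vec B (fromℕ k)) (inBox x-feasible)
  ... | inj₁ d≡0 = contradiction (trans (sym (diagonal B s)) (d≡0 (pivot B s))) λ ()
    where s = fromℕ k
  ... | inj₂ (τ , 0≤τ , within , i , di≢0 , hit) =
    x ⊕ τ ⊙ vec B s , record { inBox = within τ 0≤τ ℚ.≤-refl ; sums = sums′ } ,
    exchange (kernel-isSubspace v) B s i di≢0 ,
    λ { zero    _         → hit
      -- Omitting the last index renumbers no other, so old pivot `t` becomes number `suc t`. Its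
      -- coordinate does not move, because `vec B s` vanishes there.
      ; (suc t) (s≤s t<l) → subst (AtBound _ _) (x≡x+σd τ (offDiag B (punchInᵢ≢i s t ∘ sym)))
          (tight (punchIn s t) (subst (ℕ._< _) (sym (toℕ-punchIn-fromℕ t)) t<l))
      }
    where
    s = fromℕ k
    sums′ : w ≗ linComb (x ⊕ τ ⊙ vec B s) v
    sums′ j = begin
      w j                                        ≡⟨ sums x-feasible j ⟩
      linComb x v j                              ≡⟨ x≡x+σd τ (vec∈K B s j) ⟩
      linComb x v j + τ * linComb (vec B s) v j  ≡⟨ IsLinear.homo (linComb-isLinear v j) x τ (vec B s) ⟨
      linComb (x ⊕ τ ⊙ vec B s) v j              ∎
      where open ≡-Reasoning

  tighten : ∀ l → Tightened k 0 → Tightened k l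
  tighten         zero    T                 = T
  tighten {suc k} (suc l) T                 = tightenOnce (tighten l T)
  tighten {zero}  (suc l) (x , x-feas , B , _) = x , x-feas , B , λ ()

  -- A kernel vector is determined by its pivot entries. A feasible point with all pivot coordinates
  -- at bounds is therefore the only feasible point with these values there, that is, a vertex.
  vertex : ∀ {x} → Feasible x → ∃[ k ] Tightened k k
  vertex {x} x-feasible with k , B ← kernelBasis n v = k , tighten k (x , x-feasible , B , λ _ ())

-- Vertices have coordinates in `ℚ[ P ]`

mainTheorem6 : ∀ (n m : ℕ) (v : Vector (Vector ℚ n) m) →
    let P = relationPrimes v in
    ∀ (a b : Vector ℚ m) →
    (∀ i → a i ∈ ℚ[ P ]) → (∀ i → b i ∈ ℚ[ P ]) → (∀ i → a i ≤ b i) →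
    ∀ (w : Vector ℚ n) →
    (∃[ z ] (∀ i → z i ∈ ℚ[ P ]) × w ≗ linComb z v) →
    (∃[ x ] (∀ i → a i ≤ x i × x i ≤ b i) × w ≗ linComb x v) →
    ∃[ y ] (∀ i → y i ∈ ℚ[ P ]) × (∀ i → a i ≤ y i × y i ≤ b i) × w ≗ linComb y v
mainTheorem6 n m v a b a∈ b∈ _ w (z , z∈ , w≗z) (x , inBox , w≗x) =
  case vertex v a b w record { inBox = inBox ; sums = w≗x } of λ
    { (k , y , y-feasible , B , tight) →
        y , y∈ B y (Feasible.sums y-feasible) (λ t → tight t (Fin.toℕ<n t))
          , Feasible.inBox y-feasible , Feasible.sums y-feasible }
  where
  P = relationPrimes v

  atBound∈ : ∀ {y} i → AtBound (a i) (b i) y → y ∈ ℚ[ P ]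
  atBound∈ i = [ (λ { refl → a∈ i }) , (λ { refl → b∈ i }) ]′

  module _ (B : Basis (Kernel v) k) (y : Vector ℚ m) (w≗y : w ≗ linComb y v)
    (tight : ∀ t → AtBound (a (pivot B t)) (b (pivot B t)) (y (pivot B t))) where
    open ≡-Reasoning

    y-z : Vector ℚ m
    y-z = y ⊕ - 1ℚ ⊙ z

    y-z∈Kernel : y-z ∈ Kernel v
    y-z∈Kernel j = begin
      linComb y-z v j                       ≡⟨ IsLinear.homo (linComb-isLinear v j) y (- 1ℚ) z ⟩
      linComb y v j + - 1ℚ * linComb z v j  ≡⟨ cong₂ (λ r s → r + - 1ℚ * s) (w≗y j) (w≗z j) ⟨
      w j + - 1ℚ * w j                      ≡⟨ solve 1 (λ r → r :+ (:- con 1ℚ) :* r := con 0ℚ) refl (w j) ⟩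
      0ℚ                                    ∎

    -1z∈ : ∀ i → - 1ℚ * z i ∈ ℚ[ P ]
    -1z∈ i = ∈-* (∈-neg (fromℤ∈ 1ℤ)) (z∈ i)

    y-z∈ : ∀ i → y-z i ∈ ℚ[ P ]
    -- Subtracting `z` moves the question into the kernel. At a pivot, the difference is a bound
    -- minus an entry of `z`, both in `ℚ[ P ]`.
    y-z∈ = subring-closed (kernel-isSubspace v) ℚ[ P ] (fromℤ∈ 0ℤ) ∈-+ ∈-* ∈-neg B (vec∈ℚ[P] v B)
      y-z∈Kernel (λ t → ∈-+ (atBound∈ (pivot B t) (tight t)) (-1z∈ (pivot B t)))

    y∈ : ∀ i → y i ∈ ℚ[ P ]
    y∈ i = subst (_∈ ℚ[ P ])
      (solve 2 (λ y z → y :+ (:- con 1ℚ) :* z :+ z := y) refl (y i) (z i)) (∈-+ (y-z∈ i) (z∈ i))
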